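{- Consider the Shortest-Paths-and-Greedy-Delays algorithm described in the context, applied to min-sum Time Disjoint Walks on directed acyclic graphs of bounded maximum total degree. (i) For every fixed integer \(D\), there is a constant \(C_D\) such that for every instance with \(k\ge 2\) demands whose digraph is a DAG with maximum total degree at most \(D\), and every way of breaking ties, the cost of the algorithm's output is at most \(C_D\cdot k/\log k\) times the optimal min-sum cost. (ii) Conversely, there is a fixed integer \(D\), a constant \(c>0\), and, for infinitely many values of \(k\), an instance with \(k\) demands whose digraph is a DAG of maximum total degree at most \(D\), together with a valid way of breaking ties, on which the cost of the algorithm's output is at least \(c\cdot k/\log k\) times the optimal min-sum cost. That is, the approximation ratio of the algorithm on bounded-degree DAGs is \(\Theta(k/\log k)\).
   Context: Notation: for integers \(a,b\), \([a,b]=\{x\in\mathbb{Z}: a\le x\le b\}\) and \([b]=[1,b]\). Digraphs are finite and have no parallel arcs in the same direction; the total degree of a vertex is its indegree plus outdegree. Let \(G=(V,E)\) be a digraph with arc lengths \(\lambda:E\to\mathbb{Z}_{\ge1}\). A walk from \(u\) to \(v\) is a tuple \(W=(w_1,\dots,w_l)\) of vertices with \(w_1=u\), \(w_l=v\), \((w_i,w_{i+1})\in E\) for all \(i\in[l-1]\) (vertices may repeat). For \(j\in[l]\) let \(\lambda(W,j)=\sum_{i\in[j-1]}\lambda(w_i,w_{i+1})\) and \(\lambda(W)=\lambda(W,l)\); for a path (no repeated vertices) and a vertex \(v=w_j\) on it write \(\lambda(W,v)=\lambda(W,j)\). Given delays \(d_1,d_2\in\mathbb{Z}_{\ge0}\)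 and walks \(W_1,W_2\), the pairs \((d_1,W_1)\) and \((d_2,W_2)\) are time disjoint if for every \(j_1\in[|W_1|]\), \(j_2\in[|W_2|]\) such that the \(j_1\)-th vertex of \(W_1\) equals the \(j_2\)-th vertex of \(W_2\), we have \(d_1+\lambda(W_1,j_1)\ne d_2+\lambda(W_2,j_2)\). Time Disjoint Walks (TDW): an instance is \((G,\lambda,\mathcal{T})\) with \(\mathcal{T}=\{(s_1,t_1),\dots,(s_k,t_k)\}\subseteq V^2\) a set of \(k\) demands across unique vertices, such that for each \(i\) there is a walk from \(s_i\) to \(t_i\). A feasible solution is a choice, for each \(i\in[k]\), of a delay \(d_i\in\mathbb{Z}_{\ge0}\) and a walk \(W_i\) from \(s_i\) to \(t_i\), such that the pairs \((d_i,W_i)\) are pairwise time disjoint. Min-sum TDW minimizes \(\sum_{i\in[k]}(d_i+\lambda(W_i))\). Shortest-Paths-and-Greedy-Delays algorithm: for each \(i\in[k]\), compute a shortest (minimum \(\lambda\)-length) path \(W_i\) from \(s_i\) to \(t_i\) (e.g. by Dijkstra; ties broken arbitrarily). Relabel the demands so that \(\lambda(W_1)\le\lambda(W_2)\le\dots\le\lambda(W_k)\) (ties broken arbitrarily). Then for \(i=1,\dots,k\) in order, let \(B_i=\{d_h+\lambda(W_h,v)-\lambda(W_i,v): h\in[i-1],\ v \text{ a vertex lying on both } W_h \text{ and } W_i\}\) and set \(d_i=\min(\mathbb{Z}_{\ge0}\setminus B_i)\). Output \(\{(d_i,W_i): i\in[k]\}\). -}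

module Defs where

open import Data.Nat using (ℕ; zero; suc; _+_; _*_; _≤_; _<_)
open import Data.Nat.Logarithm using (⌊log₂_⌋)
open import Data.Fin using (Fin) renaming (_<_ to _<ᶠ_)
open import Data.Bool using (Bool; true; false)
open import Data.List using (List; []; _∷_; [_]; length; map; filterᵇ; allFin)
open import Data.Nat.ListAction using (sum)
open import Data.List.Membership.Propositional using (_∈_)
open import Data.List.Relation.Unary.Unique.Propositional using (Unique)
open import Data.Product using (Σ; ∃; ∃-syntax; _×_; _,_)
open import Relation.Binary.PropositionalEquality using (_≡_; _≢_)
open import Relation.Nullary using (¬_)
open import Function.Definitions using (Injective)

-- Digraphs on vertex set Fin n, arcs given by a Boolean adjacency
-- matrix (so there are no parallel arcs in the same direction),
-- arc lengths λ (only relevant on arcs).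

Adj : ℕ → Set
Adj n = Fin n → Fin n → Bool

Len : ℕ → Set
Len n = Fin n → Fin n → ℕ

data IsWalk {n : ℕ} (E : Adj n) : Fin n → Fin n → List (Fin n) → Set where
  single : ∀ v → IsWalk E v v [ v ]
  step   : ∀ {u v t ws} → E u v ≡ true → IsWalk E v t (v ∷ ws) →
           IsWalk E u t (u ∷ v ∷ ws)

IsPath : {n : ℕ} → Adj n → Fin n → Fin n → List (Fin n) → Set
IsPath E u v w = IsWalk E u v w × Unique w

walkLen : {n : ℕ} → Len n → List (Fin n) → ℕ
walkLen λ' []           = 0
walkLen λ' (v ∷ [])     = 0
walkLen λ' (v ∷ w ∷ ws) = λ' v w + walkLen λ' (w ∷ ws)

arrivals : {n : ℕ} → Len n → ℕ → List (Fin n) → List (Fin n × ℕ)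
arrivals λ' off []           = []
arrivals λ' off (v ∷ [])     = (v , off) ∷ []
arrivals λ' off (v ∷ w ∷ ws) = (v , off) ∷ arrivals λ' (off + λ' v w) (w ∷ ws)

TimeDisjoint : {n : ℕ} → Len n → ℕ → List (Fin n) → ℕ → List (Fin n) → Set
TimeDisjoint λ' d₁ W₁ d₂ W₂ =
  ∀ v a b → (v , a) ∈ arrivals λ' 0 W₁ → (v , b) ∈ arrivals λ' 0 W₂ →
  d₁ + a ≢ d₂ + b

IsDAG : {n : ℕ} → Adj n → Set
IsDAG {n} E = ∀ (v : Fin n) w → IsWalk E v v w → length w ≡ 1

indeg outdeg : {n : ℕ} → Adj n → Fin n → ℕ
indeg  {n} E v = length (filterᵇ (λ u → E u v) (allFin n))
outdeg {n} E v = length (filterᵇ (λ u → E v u) (allFin n))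

MaxDegreeAtMost : {n : ℕ} → Adj n → ℕ → Set
MaxDegreeAtMost E D = ∀ v → indeg E v + outdeg E v ≤ D

record Instance (k : ℕ) : Set where
  field
    n      : ℕ
    E      : Adj n
    λ'     : Len n
    λ-pos  : ∀ u v → E u v ≡ true → 1 ≤ λ' u v
    s t    : Fin k → Fin n
    s-inj  : Injective _≡_ _≡_ s
    t-inj  : Injective _≡_ _≡_ t
    s≢t    : ∀ i j → s i ≢ t j
    reach  : ∀ i → ∃[ w ] IsWalk E (s i) (t i) w

open Instance public

Schedule : ℕ → ℕ → Set
Schedule k n = (Fin k → ℕ) × (Fin k → List (Fin n))

module _ {k : ℕ} (I : Instance k) where

  private
    N = Instance.n I

  Feasible : Schedule k N → Set
  Feasible (d , W) =
    (∀ i → IsWalk (E I) (s I i) (t I i) (W i)) ×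
    (∀ i j → i ≢ j → TimeDisjoint (λ' I) (d i) (W i) (d j) (W j))

  cost : Schedule k N → ℕ
  cost (d , W) = sum (map (λ i → d i + walkLen (λ' I) (W i)) (allFin k))

  IsShortestPath : Fin N → Fin N → List (Fin N) → Set
  IsShortestPath u v w =
    IsPath (E I) u v w × (∀ w' → IsPath (E I) u v w' → walkLen (λ' I) w ≤ walkLen (λ' I) w')

  -- x ∈ B_i, for the demand at position i of the order σ:
  -- x = d_h + λ(W_h,v) − λ(W_{σ i},v) for some earlier h and a common vertex v.
  InB : (Fin k → Fin k) → Schedule k N → Fin k → ℕ → Set
  InB σ (d , W) i x =
    ∃[ j ] (j <ᶠ i × ∃[ v ] ∃[ a ] ∃[ b ]
      ((v , a) ∈ arrivals (λ' I) 0 (W (σ i)) ×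
       (v , b) ∈ arrivals (λ' I) 0 (W (σ j)) ×
       x + a ≡ d (σ j) + b))

  -- (d , W) is a possible output of the Shortest-Paths-and-Greedy-Delays
  -- algorithm for some way of breaking ties (choice of the shortest paths
  -- and of the order σ among demands with equal path length).
  AlgOutput : Schedule k N → Set
  AlgOutput (d , W) =
    (∀ i → IsShortestPath (s I i) (t I i) (W i)) ×
    Σ (Fin k → Fin k) λ σ →
      Injective _≡_ _≡_ σ ×
      (∀ i j → i <ᶠ j → walkLen (λ' I) (W (σ i)) ≤ walkLen (λ' I) (W (σ j))) ×
      (∀ i → ¬ InB σ (d , W) i (d (σ i)) ×
             (∀ x → x < d (σ i) → InB σ (d , W) i x))

-- The two parts of the theorem.  k / log k is rendered with ⌊log₂ k⌋
-- (within a constant factor of ln k for k ≥ 2); constants are naturals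
-- (C_D rounded up; c = 1/m).

UpperBound : Set
UpperBound =
  ∀ (D : ℕ) → ∃[ C ] ∀ (k : ℕ) → 2 ≤ k → (I : Instance k) →
    IsDAG (E I) → MaxDegreeAtMost (E I) D →
    ∀ (A : Schedule k (Instance.n I)) → AlgOutput I A →
    ∀ (S : Schedule k (Instance.n I)) → Feasible I S →
    cost I A * ⌊log₂ k ⌋ ≤ C * k * cost I S

LowerBound : Set
LowerBound =
  ∃[ D ] ∃[ m ] (1 ≤ m × ∀ (N : ℕ) → ∃[ k ] (N ≤ k ×
    Σ (Instance k) λ I → IsDAG (E I) × MaxDegreeAtMost (E I) D ×
    Σ (Schedule k (Instance.n I)) λ A → AlgOutput I A ×
    Σ (Schedule k (Instance.n I)) λ S → Feasible I S ×
    k * cost I S ≤ m * cost I A * ⌊log₂ k ⌋))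

{-# OPTIONS --safe #-}
-- Upper bound: two shortest paths of a DAG meet with the same time shift at all their
-- common vertices, so every earlier demand blocks at most one delay and d_i is at most the
-- number of earlier paths meeting W_i.  The sources of these paths are distinct and lie
-- within undirected distance 2 λ(W_i) of s_i, hence d_i ≤ min(k, (1+D)^(2 λ(W_i))), which
-- is O(λ(W_i) k / log k); and any solution spends at least λ(W_i) on demand i.
--
-- Lower bound: with k = 2^r, a binary in-tree followed by a binary out-tree routes all
-- demands through one vertex at time r, forcing the delays 0, 1, …, k - 1.  An additional
-- arc of length 2r from s_i to t_i is equally short, and using these arcs costs only 2rk.
module Submission where

open import Defs
open import Data.Bool using (true)
open import Data.Bool.Properties using (T-≡; T?)
open import Data.Empty using (⊥-elim)
open import Data.Fin using (Fin; zero; suc; toℕ; fromℕ<; punchOut; combine; remQuot)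
open import Data.Fin.Properties
  using (any?; _≟_; toℕ-injective; toℕ<n; toℕ-fromℕ<; injective⇒≤; punchOut-injective;
         remQuot-combine; combine-remQuot; combine-injectiveʳ)
open import Data.List
  using (List; []; _∷_; [_]; _++_; length; map; lookup; filterᵇ; allFin; concatMap; tabulate)
open import Data.List.Membership.Propositional using (_∈_)
open import Data.List.Membership.Propositional.Properties
  using (∈-lookup; ∈-filter⁺; ∈-filter⁻; ∈-allFin; ∈-++⁺ˡ; ∈-++⁺ʳ; ∈-concatMap⁺)
open import Data.List.Properties using (length-++; map-cong; map-tabulate; tabulate-cong)
open import Data.List.Relation.Unary.All as All using ([]; _∷_)
open import Data.List.Relation.Unary.AllPairs using ([]; _∷_)
open import Data.List.Relation.Unary.Any as Any using (here; there)
open import Data.List.Relation.Unary.Any.Properties using (lookup-index)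
open import Data.List.Relation.Unary.Unique.Propositional using (Unique)
open import Data.List.Relation.Unary.Unique.Propositional.Properties using (filter⁺; allFin⁺)
open import Data.Nat hiding (_≟_)
import Data.Nat as ℕ
open import Data.Nat.Induction using (<-rec)
open import Data.Nat.ListAction using (sum)
open import Data.Nat.Logarithm using (⌊log₂_⌋; ⌊log₂⌊n/2⌋⌋≡⌊log₂n⌋∸1; ⌊log₂[2^n]⌋≡n)
open import Data.Nat.Properties hiding (_≟_)
open import Data.Nat.Tactic.RingSolver using (solve-∀)
open import Data.Product using (∃-syntax; _×_; _,_; proj₁; proj₂; uncurry)
open import Data.Product.Properties using (,-injective)
open import Data.Sum using (_⊎_; inj₁; inj₂; [_,_]′)
open import Function using (_∘_; id)
open import Function.Bundles using (Equivalence)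
open import Function.Definitions using (Injective)
open import Relation.Binary.PropositionalEquality
  using (_≡_; _≢_; refl; sym; trans; cong; cong₂; subst; module ≡-Reasoning)
open import Relation.Nullary using (¬_; Dec; yes; no)
open import Relation.Nullary.Decidable using (isYes; toWitness; fromWitness; _×-dec_; _⊎-dec_)

-- Counting

injection-length : ∀ {A : Set} {m} {f : Fin m → A} (ys : List A) → Injective _≡_ _≡_ f →
                   (∀ i → f i ∈ ys) → m ≤ length ys
injection-length {f = f} ys f-inj f∈ys = injective⇒≤ λ {i} {j} eq → f-inj
  (trans (lookup-index (f∈ys i)) (trans (cong (lookup ys) eq) (sym (lookup-index (f∈ys j)))))

lookup-injective : ∀ {A : Set} {xs : List A} → Unique xs → Injective _≡_ _≡_ (lookup xs)
lookup-injective (_  ∷ _) {zero}  {zero}  _  = refl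
lookup-injective (px ∷ _) {zero}  {suc j} eq = ⊥-elim (All.lookup px (∈-lookup j) eq)
lookup-injective (px ∷ _) {suc i} {zero}  eq = ⊥-elim (All.lookup px (∈-lookup i) (sym eq))
lookup-injective (_  ∷ u) {suc i} {suc j} eq = cong suc (lookup-injective u eq)

-- A missed value could be punched out, squeezing `suc k` indices injectively into `k`. This lets
-- every demand be written as `σ j`.
injective⇒surjective : ∀ {k} (σ : Fin k → Fin k) → Injective _≡_ _≡_ σ → ∀ i → ∃[ j ] σ j ≡ i
injective⇒surjective {suc k} σ σ-inj i with any? (λ j → σ j ≟ i)
... | yes hit = hit
... | no miss = ⊥-elim (1+n≰n (injective⇒≤ {f = λ j → punchOut (missed j)}
                  λ {j} {j′} eq → σ-inj (punchOut-injective (missed j) (missed j′) eq)))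
  where
  missed : ∀ j → i ≢ σ j
  missed j eq = miss (j , sym eq)

length-concatMap-≤ : ∀ {A B : Set} (f : A → List B) {c} → (∀ x → length (f x) ≤ c) →
                     ∀ xs → length (concatMap f xs) ≤ length xs * c
length-concatMap-≤ f f≤c []       = z≤n
length-concatMap-≤ f f≤c (x ∷ xs) =
  ≤-trans (≤-reflexive (length-++ (f x))) (+-mono-≤ (f≤c x) (length-concatMap-≤ f f≤c xs))

sum-map-mono : ∀ {A : Set} {f g : A → ℕ} (c e : ℕ) → (∀ x → f x * c ≤ e * g x) →
               ∀ xs → sum (map f xs) * c ≤ e * sum (map g xs)
sum-map-mono c e le []               = z≤n
sum-map-mono {f = f} {g} c e le (x ∷ xs) = begin
  (f x + sum (map f xs)) * c       ≡⟨ *-distribʳ-+ c (f x) _ ⟩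
  f x * c + sum (map f xs) * c     ≤⟨ +-mono-≤ (le x) (sum-map-mono c e le xs) ⟩
  e * g x + e * sum (map g xs)     ≡⟨ *-distribˡ-+ e (g x) _ ⟨
  e * (g x + sum (map g xs))       ∎
  where open ≤-Reasoning

length-filterᵇ-≤ : ∀ {A : Set} {n} {f : Fin n → A} {P} (ys : List A) → Injective _≡_ _≡_ f →
                   (∀ u → P u ≡ true → f u ∈ ys) → length (filterᵇ P (allFin n)) ≤ length ys
length-filterᵇ-≤ {n = n} {P = P} ys f-inj P⇒∈ =
  injection-length ys (lookup-injective (filter⁺ (T? ∘ P) (allFin⁺ n)) ∘ f-inj)
    λ i → P⇒∈ _ (Equivalence.to T-≡ (proj₂ (∈-filter⁻ (T? ∘ P) {xs = allFin n} (∈-lookup i))))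

-- The summand `k` on the left avoids the subtraction in the triangular number; the offset `c` is
-- general because it grows by one in each induction step.
sum-tabulate-toℕ : ∀ k c → 2 * sum (tabulate {n = k} (λ i → toℕ i + c)) + k ≡ k * k + 2 * k * c
sum-tabulate-toℕ zero    c = refl
sum-tabulate-toℕ (suc k) c = begin
  2 * (c + sum (tabulate {n = k} (λ i → suc (toℕ i) + c))) + suc k
    ≡⟨ cong (λ f → 2 * (c + sum f) + suc k) (tabulate-cong {n = k} λ i → sym (+-suc (toℕ i) c)) ⟩
  2 * (c + sum (tabulate {n = k} (λ i → toℕ i + suc c))) + suc k
    ≡⟨ regroup c (sum (tabulate {n = k} (λ i → toℕ i + suc c))) k ⟩
  2 * sum (tabulate {n = k} (λ i → toℕ i + suc c)) + k + (2 * c + 1)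
    ≡⟨ cong (_+ (2 * c + 1)) (sum-tabulate-toℕ k (suc c)) ⟩
  k * k + 2 * k * suc c + (2 * c + 1)
    ≡⟨ regroup′ k c ⟩
  suc k * suc k + 2 * suc k * c ∎
  where
  open ≡-Reasoning
  regroup : ∀ c x k → 2 * (c + x) + suc k ≡ 2 * x + k + (2 * c + 1)
  regroup = solve-∀
  regroup′ : ∀ k c → k * k + 2 * k * suc c + (2 * c + 1) ≡ suc k * suc k + 2 * suc k * c
  regroup′ = solve-∀

sum-tabulate-const : ∀ k c → sum (tabulate {n = k} (λ _ → c)) ≡ k * c
sum-tabulate-const zero    c = refl
sum-tabulate-const (suc k) c = cong (c +_) (sum-tabulate-const k c)

-- Powers of two and the binary logarithm

1+n≤2^n : ∀ n → suc n ≤ 2 ^ n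
1+n≤2^n zero    = ≤-refl
1+n≤2^n (suc n) = begin
  suc (suc n)      ≤⟨ s≤s (1+n≤2^n n) ⟩
  1 + 2 ^ n        ≤⟨ +-monoˡ-≤ (2 ^ n) (m^n>0 2 n) ⟩
  2 ^ n + 2 ^ n    ≡⟨ cong (2 ^ n +_) (+-identityʳ (2 ^ n)) ⟨
  2 ^ suc n        ∎
  where open ≤-Reasoning

2*⌊n/2⌋≤n : ∀ n → 2 * ⌊ n /2⌋ ≤ n
2*⌊n/2⌋≤n n = begin
  2 * ⌊ n /2⌋            ≡⟨ cong (⌊ n /2⌋ +_) (+-identityʳ _) ⟩
  ⌊ n /2⌋ + ⌊ n /2⌋      ≤⟨ +-monoʳ-≤ ⌊ n /2⌋ (⌊n/2⌋≤⌈n/2⌉ n) ⟩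
  ⌊ n /2⌋ + ⌈ n /2⌉      ≡⟨ ⌊n/2⌋+⌈n/2⌉≡n n ⟩
  n                      ∎
  where open ≤-Reasoning

n≡2*⌊n/2⌋∨1+2*⌊n/2⌋ : ∀ n → n ≡ 2 * ⌊ n /2⌋ ⊎ n ≡ suc (2 * ⌊ n /2⌋)
n≡2*⌊n/2⌋∨1+2*⌊n/2⌋ zero          = inj₁ refl
n≡2*⌊n/2⌋∨1+2*⌊n/2⌋ (suc zero)    = inj₂ refl
n≡2*⌊n/2⌋∨1+2*⌊n/2⌋ (suc (suc n)) =
  [ (λ eq → inj₁ (lift eq)) , (λ eq → inj₂ (cong suc (lift′ eq))) ]′ (n≡2*⌊n/2⌋∨1+2*⌊n/2⌋ n)
  where
  lift : n ≡ 2 * ⌊ n /2⌋ → suc (suc n) ≡ 2 * suc ⌊ n /2⌋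
  lift eq = trans (cong (2 +_) eq) (sym (*-suc 2 ⌊ n /2⌋))
  lift′ : n ≡ suc (2 * ⌊ n /2⌋) → suc n ≡ 2 * suc ⌊ n /2⌋
  lift′ eq = trans (cong suc eq) (sym (*-suc 2 ⌊ n /2⌋))

2^⌊log₂n⌋≤n : ∀ n → 1 ≤ n → 2 ^ ⌊log₂ n ⌋ ≤ n
2^⌊log₂n⌋≤n = <-rec _ go
  where
  open ≤-Reasoning
  go : ∀ n → (∀ {m} → m < n → 1 ≤ m → 2 ^ ⌊log₂ m ⌋ ≤ m) → 1 ≤ n → 2 ^ ⌊log₂ n ⌋ ≤ n
  go 1                 rec _ = ≤-refl
  go n@(suc (suc n-2)) rec _ = begin
    -- Uses l ≤ 1 + (l ∸ 1), since the halving law for the logarithm is stated with truncated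
    -- subtraction.
    2 ^ ⌊log₂ n ⌋                ≤⟨ ^-monoʳ-≤ 2 (m≤n+m∸n ⌊log₂ n ⌋ 1) ⟩
    2 * 2 ^ (⌊log₂ n ⌋ ∸ 1)      ≡⟨ cong (λ l → 2 * 2 ^ l) (⌊log₂⌊n/2⌋⌋≡⌊log₂n⌋∸1 n) ⟨
    2 * 2 ^ ⌊log₂ ⌊ n /2⌋ ⌋      ≤⟨ *-monoʳ-≤ 2 (rec (⌊n/2⌋<n (suc n-2)) (s≤s z≤n)) ⟩
    2 * ⌊ n /2⌋                  ≤⟨ 2*⌊n/2⌋≤n n ⟩
    n                            ∎

-- Split l = a + e with a ≤ e; then l ≤ 2e ≤ 2 · 2^e, and the factor 2^e completes 2^a to 2^l.
m≤2^a⇒m*l≤2^1+l : ∀ {a l m} → a + a ≤ l → m ≤ 2 ^ a → m * l ≤ 2 * 2 ^ l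
m≤2^a⇒m*l≤2^1+l {a} {m = m} 2a≤l m≤2^a
  with e , refl ← m≤n⇒∃[o]m+o≡n (≤-trans (m≤m+n a a) 2a≤l) = begin
  m * (a + e)              ≤⟨ *-mono-≤ m≤2^a (+-monoˡ-≤ e (+-cancelˡ-≤ a a e 2a≤l)) ⟩
  2 ^ a * (e + e)          ≤⟨ *-monoʳ-≤ (2 ^ a) (+-mono-≤ e≤2^e e≤2^e) ⟩
  2 ^ a * (2 ^ e + 2 ^ e)  ≡⟨ double (2 ^ a) (2 ^ e) ⟩
  2 * (2 ^ a * 2 ^ e)      ≡⟨ cong (2 *_) (^-distribˡ-+-* 2 a e) ⟨
  2 * 2 ^ (a + e)          ∎
  where
  open ≤-Reasoning
  e≤2^e = ≤-trans (n≤1+n e) (1+n≤2^n e)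
  double : ∀ x y → x * (y + y) ≡ 2 * (x * y)
  double = solve-∀

-- The two bounds d ≤ k and d ≤ 2^(cℓ) balance at ℓ ≈ log k: above that threshold
-- d ≤ k already costs only a factor k / log k, below it d is at most √k.
delay-tradeoff : ∀ {c d k ℓ} → 1 ≤ k → 1 ≤ ℓ → d ≤ k → d ≤ 2 ^ (c * ℓ) →
                 d * ⌊log₂ k ⌋ ≤ (c + c + 2) * k * ℓ
delay-tradeoff {c} {d} {k} {ℓ} 1≤k 1≤ℓ d≤k d≤2^cℓ with ≤-total ⌊log₂ k ⌋ (c * ℓ + c * ℓ)
... | inj₁ log≤2cℓ = begin
  d * ⌊log₂ k ⌋               ≤⟨ *-mono-≤ d≤k log≤2cℓ ⟩
  k * (c * ℓ + c * ℓ)         ≤⟨ m≤m+n _ (2 * k * ℓ) ⟩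
  k * (c * ℓ + c * ℓ) + 2 * k * ℓ ≡⟨ regroup c k ℓ ⟩
  (c + c + 2) * k * ℓ         ∎
  where
  open ≤-Reasoning
  regroup : ∀ c k ℓ → k * (c * ℓ + c * ℓ) + 2 * k * ℓ ≡ (c + c + 2) * k * ℓ
  regroup = solve-∀
... | inj₂ 2cℓ≤log = begin
  d * ⌊log₂ k ⌋               ≤⟨ m≤2^a⇒m*l≤2^1+l {c * ℓ} 2cℓ≤log d≤2^cℓ ⟩
  2 * 2 ^ ⌊log₂ k ⌋           ≤⟨ *-monoʳ-≤ 2 (2^⌊log₂n⌋≤n k 1≤k) ⟩
  2 * k                       ≡⟨ *-identityʳ (2 * k) ⟨
  2 * k * 1                   ≤⟨ *-mono-≤ (*-monoˡ-≤ k (m≤n+m 2 (c + c))) 1≤ℓ ⟩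
  (c + c + 2) * k * ℓ         ∎
  where open ≤-Reasoning

-- Walks in directed acyclic graphs

module _ {n : ℕ} (E : Adj n) (λ' : Len n) where

  -- Only endpoints and length of a walk are kept, so that concatenation becomes addition.
  Reach : Fin n → Fin n → ℕ → Set
  Reach u v ℓ = ∃[ w ] (IsWalk E u v w × walkLen λ' w ≡ ℓ)

  -- Compares with all walks, not just paths, so that pieces of different walks can be spliced
  -- without checking for repeated vertices.
  Minimal : Fin n → Fin n → ℕ → Set
  Minimal u t ℓ = ∀ {ℓ′} → Reach u t ℓ′ → ℓ ≤ ℓ′

  -- v is passed at time a and v′ later (or simultaneously) at time a′ on a walk
  -- from u to t of length ℓ that starts at time o.
  Ordered : Fin n → Fin n → ℕ → ℕ → Fin n × ℕ → Fin n × ℕ → Set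
  Ordered u t ℓ o (v , a) (v′ , a′) = ∃[ p ] ∃[ x ] ∃[ q ]
    (Reach u v p × Reach v v′ x × Reach v′ t q × a ≡ o + p × a′ ≡ a + x × ℓ ≡ p + x + q)

module _ {n : ℕ} {E : Adj n} where

  walk-prefix : ∀ {u t v ws} → IsWalk E u t ws → v ∈ ws → ∃[ p ] IsWalk E u v p
  walk-prefix (single _) (here refl) = _ , single _
  walk-prefix (step _ _) (here refl) = _ , single _
  walk-prefix (step e w) (there v∈)  with walk-prefix w v∈
  ... | _ , p@(single _) = _ , step e p
  ... | _ , p@(step _ _) = _ , step e p

  -- A repeated vertex would cut out a closed walk with at least one arc.
  walk-unique : IsDAG E → ∀ {u t ws} → IsWalk E u t ws → Unique ws
  walk-unique dag (single _) = [] ∷ []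
  walk-unique dag {u} (step {v = v} {ws = ws} e w) = All.tabulate fresh ∷ walk-unique dag w
    where
    fresh : ∀ {x} → x ∈ v ∷ ws → u ≢ x
    fresh x∈ refl with walk-prefix w x∈
    ... | _ , p@(single _) with () ← dag u _ (step e p)
    ... | _ , p@(step _ _) with () ← dag u _ (step e p)

module _ {n : ℕ} {E : Adj n} {λ' : Len n} where

  reach-refl : ∀ {v} → Reach E λ' v v 0
  reach-refl {v} = [ v ] , single v , refl

  reach-step : ∀ {u v t ℓ} → E u v ≡ true → Reach E λ' v t ℓ → Reach E λ' u t (λ' u v + ℓ)
  reach-step e (_ , w@(single _) , refl) = _ , step e w , refl
  reach-step e (_ , w@(step _ _) , refl) = _ , step e w , refl

  reach-trans : ∀ {u v t x y} → Reach E λ' u v x → Reach E λ' v t y → Reach E λ' u t (x + y)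
  reach-trans (_ , single _ , refl) r = r
  reach-trans {t = t} {y = y} (u ∷ v ∷ ws , step e w , refl) r =
    subst (Reach E λ' u t) (sym (+-assoc (λ' u v) (walkLen λ' (v ∷ ws)) y))
      (reach-step e (reach-trans (_ , w , refl) r))

  closed-length : IsDAG E → ∀ {v ℓ} → Reach E λ' v v ℓ → ℓ ≡ 0
  closed-length dag (_ , single _ , refl) = refl
  closed-length dag {v} (_ , w@(step _ _) , refl) with () ← dag v _ w

  -- The offset `o` is general because `arrivals` advances it along the walk.
  arrival-split : ∀ {u t ws v a} o → IsWalk E u t ws → (v , a) ∈ arrivals λ' o ws →
                  ∃[ p ] ∃[ q ] (Reach E λ' u v p × Reach E λ' v t q ×
                                 a ≡ o + p × walkLen λ' ws ≡ p + q)
  arrival-split o (single _) (here refl) =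
    0 , 0 , reach-refl , reach-refl , sym (+-identityʳ o) , refl
  arrival-split o w@(step _ _) (here refl) =
    0 , _ , reach-refl , (_ , w , refl) , sym (+-identityʳ o) , refl
  arrival-split {u} o (step {v = v} e w) (there v∈)
    with p , q , r , r′ , refl , eq ← arrival-split (o + λ' u v) w v∈ =
    _ , q , reach-step e r , r′ , +-assoc o (λ' u v) p ,
    trans (cong (λ' u v +_) eq) (sym (+-assoc (λ' u v) p q))

  ordered-step : ∀ {u v t ℓ o A B} → E u v ≡ true → Ordered E λ' v t ℓ (o + λ' u v) A B →
                 Ordered E λ' u t (λ' u v + ℓ) o A B
  ordered-step {u} {v} {o = o} e (p , x , q , r , r′ , r″ , eq , eq′ , refl) =
    λ' u v + p , x , q , reach-step e r , r′ , r″ , trans eq (+-assoc o (λ' u v) p) , eq′ ,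
    regroup (λ' u v) p x q
    where
    regroup : ∀ l p x q → l + (p + x + q) ≡ l + p + x + q
    regroup = solve-∀

  arrivals-ordered : ∀ {u t ws A B} o → IsWalk E u t ws →
                     A ∈ arrivals λ' o ws → B ∈ arrivals λ' o ws →
                     Ordered E λ' u t (walkLen λ' ws) o A B ⊎ Ordered E λ' u t (walkLen λ' ws) o B A
  arrivals-ordered o w@(single _) (here refl) B∈
    with x , q , r , r′ , eq , eq′ ← arrival-split o w B∈ =
    inj₁ (0 , x , q , reach-refl , r , r′ , sym (+-identityʳ o) , eq , eq′)
  arrivals-ordered o w@(step _ _) (here refl) B∈
    with x , q , r , r′ , eq , eq′ ← arrival-split o w B∈ =
    inj₁ (0 , x , q , reach-refl , r , r′ , sym (+-identityʳ o) , eq , eq′)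
  arrivals-ordered o w@(step _ _) A∈@(there _) (here refl)
    with x , q , r , r′ , eq , eq′ ← arrival-split o w A∈ =
    inj₂ (0 , x , q , reach-refl , r , r′ , sym (+-identityʳ o) , eq , eq′)
  arrivals-ordered {u} {t} o (step {v = v} {ws = ws} e w) (there A∈) (there B∈)
    with arrivals-ordered (o + λ' u v) w A∈ B∈
  ... | inj₁ ord = inj₁ (ordered-step e ord)
  ... | inj₂ ord = inj₂ (ordered-step e ord)

  -- Exchange argument: replacing the segment from `A` to `B` by another walk of length `x` yields a
  -- walk from `u` to `t`, which cannot be shorter than `ℓ`.
  segment-minimal : ∀ {u t ℓ o A B x} → Minimal E λ' u t ℓ → Ordered E λ' u t ℓ o A B →
                    Reach E λ' (proj₁ A) (proj₁ B) x → proj₂ B ≤ proj₂ A + x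
  segment-minimal {o = o} {x = x} min (p , y , q , r , _ , r″ , refl , refl , refl) r′ =
    +-monoʳ-≤ (o + p) (+-cancelˡ-≤ p y x (+-cancelʳ-≤ q (p + y) (p + x)
      (min (reach-trans (reach-trans r r′) r″))))

  -- The segment of either path between `v` and `v′` competes with that of the other, so both have
  -- the same length.
  shift-parallel : ∀ {u t ℓ u′ t′ ℓ′ v v′ a a′ b b′} →
    Minimal E λ' u t ℓ → Minimal E λ' u′ t′ ℓ′ →
    Ordered E λ' u t ℓ 0 (v , a) (v′ , a′) → Ordered E λ' u′ t′ ℓ′ 0 (v , b) (v′ , b′) →
    a + b′ ≡ a′ + b
  shift-parallel {a = a} {a′} {b} {b′} min min′
    o@(_ , x , _ , _ , r , _ , _ , eq , _) o′@(_ , x′ , _ , _ , r′ , _ , _ , eq′ , _) =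
    ≤-antisym
      (begin
        a + b′         ≤⟨ +-monoʳ-≤ a (segment-minimal min′ o′ r) ⟩
        a + (b + x)    ≡⟨ exchange a b x ⟩
        a + x + b      ≡⟨ cong (_+ b) eq ⟨
        a′ + b         ∎)
      (begin
        a′ + b         ≤⟨ +-monoˡ-≤ b (segment-minimal min o r′) ⟩
        a + x′ + b     ≡⟨ exchange a b x′ ⟨
        a + (b + x′)   ≡⟨ cong (a +_) eq′ ⟨
        a + b′         ∎)
    where
    open ≤-Reasoning
    exchange : ∀ a b x → a + (b + x) ≡ a + x + b
    exchange = solve-∀

  -- Opposite orders close a walk through `v` and `v′`; acyclicity makes both segments have length
  -- 0.
  shift-antiparallel : ∀ {u t ℓ u′ t′ ℓ′ v v′ a a′ b b′} → IsDAG E →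
    Ordered E λ' u t ℓ 0 (v , a) (v′ , a′) → Ordered E λ' u′ t′ ℓ′ 0 (v′ , b′) (v , b) →
    a + b′ ≡ a′ + b
  shift-antiparallel {a = a} {b′ = b′} dag
    (_ , x , _ , _ , r , _ , _ , refl , _) (_ , y , _ , _ , r′ , _ , _ , refl , _)
    with x+y≡0 ← closed-length dag (reach-trans r r′)
    with refl ← m+n≡0⇒m≡0 x x+y≡0
    with refl ← m+n≡0⇒n≡0 x x+y≡0 = sym (cong₂ _+_ (+-identityʳ a) (+-identityʳ b′))

  -- Two shortest paths of a DAG traverse their common vertices in the same order and
  -- with the same distances in between, so their time shift does not depend on the vertex.
  shift-unique : IsDAG E → ∀ {u t u′ t′ ws ws′ v v′ a a′ b b′} →
    IsWalk E u t ws → Minimal E λ' u t (walkLen λ' ws) →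
    IsWalk E u′ t′ ws′ → Minimal E λ' u′ t′ (walkLen λ' ws′) →
    (v , a) ∈ arrivals λ' 0 ws → (v′ , a′) ∈ arrivals λ' 0 ws →
    (v , b) ∈ arrivals λ' 0 ws′ → (v′ , b′) ∈ arrivals λ' 0 ws′ →
    a + b′ ≡ a′ + b
  shift-unique dag w min w′ min′ a∈ a′∈ b∈ b′∈
    with arrivals-ordered 0 w a∈ a′∈ | arrivals-ordered 0 w′ b∈ b′∈
  ... | inj₁ o | inj₁ o′ = shift-parallel min min′ o o′
  ... | inj₂ o | inj₂ o′ = sym (shift-parallel min min′ o o′)
  ... | inj₁ o | inj₂ o′ = shift-antiparallel dag o o′
  ... | inj₂ o | inj₁ o′ = sym (shift-antiparallel dag o o′)

-- Balls of the underlying undirected graph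

module _ {n : ℕ} (E : Adj n) where

  Adjacent : Fin n → Fin n → Set
  Adjacent u v = E u v ≡ true ⊎ E v u ≡ true

  neighbours : Fin n → List (Fin n)
  neighbours v = filterᵇ (λ u → E u v) (allFin n) ++ filterᵇ (λ u → E v u) (allFin n)

  -- Vertices may be listed repeatedly, since only an upper bound on the length matters. Keeping `v`
  -- beside its neighbours makes the balls grow with `m`, at the price of the factor `suc D` instead
  -- of `D`.
  ball : ℕ → Fin n → List (Fin n)
  ball zero    v = [ v ]
  ball (suc m) v = concatMap (ball m) (v ∷ neighbours v)

  -- `stay` has an arbitrary index, so `m` bounds the number of hops instead of counting them.
  data Connected : ℕ → Fin n → Fin n → Set where
    stay : ∀ {m v} → Connected m v v
    hop  : ∀ {m u v w} → Adjacent u v → Connected m v w → Connected (suc m) u w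

module _ {n : ℕ} {E : Adj n} where

  ∈-neighbours : ∀ {u v} → Adjacent E u v → v ∈ neighbours E u
  ∈-neighbours {u} {v} (inj₁ e) = ∈-++⁺ʳ (filterᵇ (λ w → E w u) (allFin n))
    (∈-filter⁺ (λ w → T? (E u w)) (∈-allFin v) (Equivalence.from T-≡ e))
  ∈-neighbours {u} {v} (inj₂ e) = ∈-++⁺ˡ
    (∈-filter⁺ (λ w → T? (E w u)) (∈-allFin v) (Equivalence.from T-≡ e))

  ∈-ball : ∀ {m u v} → Connected E m u v → v ∈ ball E m u
  ∈-ball {zero}  stay      = here refl
  ∈-ball {suc m} stay      = ∈-++⁺ˡ (∈-ball (stay {m = m}))
  ∈-ball {suc m} {u} (hop e c) = ∈-concatMap⁺ (ball E m) {xs = u ∷ neighbours E u}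
    (there (Any.map (λ { refl → ∈-ball c }) (∈-neighbours e)))

  length-ball : ∀ {D} → MaxDegreeAtMost E D → ∀ m v → length (ball E m v) ≤ suc D ^ m
  length-ball deg zero    v = ≤-refl
  length-ball {D} deg (suc m) v = begin
    length (ball E (suc m) v)
      ≤⟨ length-concatMap-≤ (ball E m) (length-ball deg m) (v ∷ neighbours E v) ⟩
    length (v ∷ neighbours E v) * suc D ^ m      ≤⟨ *-monoˡ-≤ (suc D ^ m) (s≤s degree-v) ⟩
    suc D ^ suc m                                ∎
    where
    open ≤-Reasoning
    degree-v : length (neighbours E v) ≤ D
    degree-v = ≤-trans (≤-reflexive (length-++ (filterᵇ (λ u → E u v) (allFin n)))) (deg v)

  connected-mono : ∀ {m m′ u v} → m ≤ m′ → Connected E m u v → Connected E m′ u v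
  connected-mono _         stay      = stay
  connected-mono (s≤s m≤m′) (hop e c) = hop e (connected-mono m≤m′ c)

  connected-trans : ∀ {m m′ u v w} → Connected E m u v → Connected E m′ v w →
                    Connected E (m + m′) u w
  connected-trans {m} {m′} stay c = connected-mono (m≤n+m m′ m) c
  connected-trans (hop e c) c′    = hop e (connected-trans c c′)

  connected-sym : ∀ {m u v} → Connected E m u v → Connected E m v u
  connected-sym stay = stay
  connected-sym {suc m} {u} {v} (hop {v = w} e c) =
    subst (λ l → Connected E l v u) (+-comm m 1)
      (connected-trans (connected-sym c) (hop ([ inj₂ , inj₁ ]′ e) stay))

  -- Arcs have length at least 1, so a walk has at most as many arcs as its length.
  reach⇒connected : ∀ {λ' : Len n} → (∀ u v → E u v ≡ true → 1 ≤ λ' u v) →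
                    ∀ {u v ℓ} → Reach E λ' u v ℓ → Connected E ℓ u v
  reach⇒connected pos (_ , single _ , refl) = stay
  reach⇒connected pos (_ , step e w , refl) =
    connected-mono (+-monoˡ-≤ _ (pos _ _ e)) (hop (inj₁ e) (reach⇒connected pos (_ , w , refl)))

-- Upper bound

module _ {k : ℕ} (I : Instance k) (dag : IsDAG (E I)) where

  -- The algorithm's paths are compared with paths only, but in a DAG every walk is a path.
  shortest⇒minimal : ∀ {u v w} → IsShortestPath I u v w → Minimal (E I) (λ' I) u v (walkLen (λ' I) w)
  shortest⇒minimal (_ , min) (w′ , walk , refl) = min w′ (walk , walk-unique dag walk)

  distance-positive : ∀ i {ℓ} → Reach (E I) (λ' I) (s I i) (t I i) ℓ → 1 ≤ ℓ
  distance-positive i (_ , walk , refl) = positive (s≢t I i i) walk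
    where
    positive : ∀ {u v ws} → u ≢ v → IsWalk (E I) u v ws → 1 ≤ walkLen (λ' I) ws
    positive u≢v (single _) = ⊥-elim (u≢v refl)
    positive u≢v (step e w) = ≤-trans (λ-pos I _ _ e) (m≤m+n _ _)

  module _ {D : ℕ} (deg : MaxDegreeAtMost (E I) D) {A : Schedule k (n I)} (alg : AlgOutput I A) where

    private
      d = proj₁ A
      W = proj₂ A
      paths = proj₁ alg
      σ = proj₁ (proj₂ alg)
      σ-inj = proj₁ (proj₂ (proj₂ alg))
      sorted = proj₁ (proj₂ (proj₂ (proj₂ alg)))
      greedy = proj₂ (proj₂ (proj₂ (proj₂ alg)))
      ℓ : Fin k → ℕ
      ℓ i = walkLen (λ' I) (W i)
      walk : ∀ i → IsWalk (E I) (s I i) (t I i) (W i)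
      walk i = proj₁ (proj₁ (paths i))

    module _ (i : Fin k) where

      blocked : (x : Fin (d (σ i))) → InB I σ A i (toℕ x)
      blocked x = proj₂ (greedy i) (toℕ x) (toℕ<n x)

      blocker : Fin (d (σ i)) → Fin k
      blocker x = σ (proj₁ (blocked x))

      -- A delay blocked by demand `σ j` equals `d (σ j)` plus the time shift between the two paths,
      -- and by `shift-unique` that shift is the same at every common vertex.
      blocker-injective : Injective _≡_ _≡_ blocker
      blocker-injective {x} {y} eq with blocked x | blocked y
      ... | j , _ , _ , a , b , a∈ , b∈ , xa≡db | j′ , _ , _ , a′ , b′ , a′∈ , b′∈ , ya′≡db′
        -- The common summand `a + b′ + d (σ j)`, cancelled at the end, replaces subtraction of the
        -- two blocking equations.
        with refl ← σ-inj eq = toℕ-injective (+-cancelʳ-≡ (a + b′ + d (σ j)) (toℕ x) (toℕ y) (begin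
          toℕ x + (a + b′ + d (σ j))     ≡⟨ regroup (toℕ x) a b′ (d (σ j)) ⟩
          toℕ x + a + (d (σ j) + b′)     ≡⟨ cong₂ _+_ xa≡db (sym ya′≡db′) ⟩
          d (σ j) + b + (toℕ y + a′)     ≡⟨ regroup′ (d (σ j)) b (toℕ y) a′ ⟩
          toℕ y + (a′ + b + d (σ j))     ≡⟨ cong (λ z → toℕ y + (z + d (σ j))) shift ⟨
          toℕ y + (a + b′ + d (σ j))     ∎))
        where
        open ≡-Reasoning
        shift : a + b′ ≡ a′ + b
        shift = shift-unique dag (walk (σ i)) (shortest⇒minimal (paths (σ i)))
                                 (walk (σ j)) (shortest⇒minimal (paths (σ j))) a∈ a′∈ b∈ b′∈
        regroup : ∀ x a b d → x + (a + b + d) ≡ x + a + (d + b)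
        regroup = solve-∀
        regroup′ : ∀ d b y a → d + b + (y + a) ≡ y + (a + b + d)
        regroup′ = solve-∀

      -- Follow the path of `σ i` to the common vertex, then the blocker's path back to its source.
      -- The blocker comes earlier in the sorted order, so both legs have length at most `ℓ (σ i)`.
      blocker-near : ∀ x → s I (blocker x) ∈ ball (E I) (ℓ (σ i) + ℓ (σ i)) (s I (σ i))
      blocker-near x with j , j<i , v , a , b , a∈ , b∈ , _ ← blocked x
        with p , q , r , _ , _ , eq ← arrival-split 0 (walk (σ i)) a∈
        with p′ , q′ , r′ , _ , _ , eq′ ← arrival-split 0 (walk (σ j)) b∈ =
        ∈-ball (connected-trans
          (connected-mono (m+n≤o⇒m≤o p (≤-reflexive (sym eq))) (reach⇒connected (λ-pos I) r))
          (connected-mono (≤-trans (m+n≤o⇒m≤o p′ (≤-reflexive (sym eq′))) (sorted j i j<i))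
            (connected-sym (reach⇒connected (λ-pos I) r′))))

      delay≤k : d (σ i) ≤ k
      delay≤k = injective⇒≤ blocker-injective

      -- Distinct blockers have distinct sources, all in one ball of radius 2 `ℓ (σ i)`. Base 2 is
      -- the form that `delay-tradeoff` expects.
      delay≤2^ : d (σ i) ≤ 2 ^ ((D + D) * ℓ (σ i))
      delay≤2^ = begin
        d (σ i)                              ≤⟨ injection-length _ (blocker-injective ∘ s-inj I) blocker-near ⟩
        length (ball (E I) r (s I (σ i)))    ≤⟨ length-ball deg r (s I (σ i)) ⟩
        suc D ^ r                            ≤⟨ ^-monoˡ-≤ r (1+n≤2^n D) ⟩
        (2 ^ D) ^ r                          ≡⟨ ^-*-assoc 2 D r ⟩
        2 ^ (D * r)                          ≡⟨ cong (2 ^_) (distrib D (ℓ (σ i))) ⟩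
        2 ^ ((D + D) * ℓ (σ i))              ∎
        where
        open ≤-Reasoning
        r = ℓ (σ i) + ℓ (σ i)
        distrib : ∀ D l → D * (l + l) ≡ (D + D) * l
        distrib = solve-∀

    -- `delay-tradeoff` with c = 2D contributes 4D + 2 to the constant; the path length contributes
    -- 1 more because log k ≤ k.
    completion-bound : 1 ≤ k → ∀ i → (d i + ℓ i) * ⌊log₂ k ⌋ ≤ (D + D + (D + D) + 3) * k * ℓ i
    completion-bound 1≤k i with j , refl ← injective⇒surjective σ σ-inj i = begin
      (d i + l) * ⌊log₂ k ⌋                              ≡⟨ *-distribʳ-+ ⌊log₂ k ⌋ (d i) l ⟩
      d i * ⌊log₂ k ⌋ + l * ⌊log₂ k ⌋                    ≤⟨ +-mono-≤ delay-part (*-monoʳ-≤ l log≤k) ⟩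
      (D + D + (D + D) + 2) * k * l + l * k              ≡⟨ collect (D + D + (D + D)) k l ⟩
      (D + D + (D + D) + 3) * k * l                      ∎
      where
      open ≤-Reasoning
      l = ℓ i
      delay-part = delay-tradeoff {D + D} 1≤k (distance-positive i (_ , walk i , refl)) (delay≤k j) (delay≤2^ j)
      log≤k : ⌊log₂ k ⌋ ≤ k
      log≤k = <⇒≤ (≤-trans (1+n≤2^n ⌊log₂ k ⌋) (2^⌊log₂n⌋≤n k 1≤k))
      collect : ∀ c k l → (c + 2) * k * l + l * k ≡ (c + 3) * k * l
      collect = solve-∀

-- The comparison is made demand by demand: the walk in `S` is no shorter than the algorithm's path,
-- and a delay in `S` only adds cost.
upper-bound : UpperBound
upper-bound D = D + D + (D + D) + 3 , λ k 2≤k I dag deg A alg S feas →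
  sum-map-mono ⌊log₂ k ⌋ ((D + D + (D + D) + 3) * k)
    (λ i → ≤-trans (completion-bound I dag deg {A} alg (<⇒≤ 2≤k) i)
      (*-monoʳ-≤ ((D + D + (D + D) + 3) * k)
        (≤-trans (shortest⇒minimal I dag (proj₁ alg i) (_ , proj₁ feas i , refl)) (m≤n+m _ _))))
    (allFin k)

-- Graded digraphs

-- Taking the level difference as arc length makes all walks between two given
-- vertices equally long, hence all of them shortest.
module Graded {n : ℕ} (E : Adj n) (level : Fin n → ℕ)
              (ascending : ∀ {u v} → E u v ≡ true → level u < level v) where

  gap : Len n
  gap u v = level v ∸ level u

  walk-ascending : ∀ {u v ws} → IsWalk E u v ws → level u ≤ level v
  walk-ascending (single _) = ≤-refl
  walk-ascending (step e w) = ≤-trans (<⇒≤ (ascending e)) (walk-ascending w)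

  graded⇒dag : IsDAG E
  graded⇒dag v _ (single _) = refl
  graded⇒dag v _ (step e w) = ⊥-elim (<-irrefl refl (<-≤-trans (ascending e) (walk-ascending w)))

  gap-arc : ∀ {u v} → E u v ≡ true → gap u v + level u ≡ level v
  gap-arc e = m∸n+n≡m (<⇒≤ (ascending e))

  -- The level differences telescope; the additive form avoids truncated subtraction.
  walkLen-gap : ∀ {u v ws} → IsWalk E u v ws → walkLen gap ws + level u ≡ level v
  walkLen-gap (single _) = refl
  walkLen-gap {u} (step {v = v} {ws = ws} e w) = begin
    gap u v + walkLen gap (v ∷ ws) + level u      ≡⟨ regroup (gap u v) (walkLen gap (v ∷ ws)) (level u) ⟩
    walkLen gap (v ∷ ws) + (gap u v + level u)    ≡⟨ cong (walkLen gap (v ∷ ws) +_) (gap-arc e) ⟩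
    walkLen gap (v ∷ ws) + level v                ≡⟨ walkLen-gap w ⟩
    _                                             ∎
    where
    open ≡-Reasoning
    regroup : ∀ a b c → a + b + c ≡ b + (a + c)
    regroup = solve-∀

  arrival-gap : ∀ {u v ws x a} → IsWalk E u v ws → (x , a) ∈ arrivals gap 0 ws → a + level u ≡ level x
  arrival-gap {u} w x∈ with _ , _ , (_ , p , refl) , _ , refl , _ ← arrival-split 0 w x∈ = walkLen-gap p

-- Walks traced by a function of the step number

∈-arrivals : ∀ {n} {λ' : Len n} {v ws} o → v ∈ ws → ∃[ a ] (v , a) ∈ arrivals λ' o ws
∈-arrivals {ws = _ ∷ []}     o (here refl) = o , here refl
∈-arrivals {ws = _ ∷ _ ∷ _}  o (here refl) = o , here refl
∈-arrivals {ws = _ ∷ _ ∷ _}  o (there v∈)  with a , a∈ ← ∈-arrivals _ v∈ = a , there a∈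

-- Lists `g 0` to `g m`. The helper `rest` keeps the result a visible cons for variable `m`, as the
-- constructor `step` requires.
trace : ∀ {A : Set} → (ℕ → A) → ℕ → List A
trace g m = g 0 ∷ rest g m
  where
  rest : ∀ {A : Set} → (ℕ → A) → ℕ → List A
  rest g zero    = []
  rest g (suc m) = g 1 ∷ rest (g ∘ suc) m

trace-walk : ∀ {n} {E : Adj n} {g : ℕ → Fin n} m → (∀ i → i < m → E (g i) (g (suc i)) ≡ true) →
             IsWalk E (g 0) (g m) (trace g m)
trace-walk zero    arcs = single _
trace-walk (suc m) arcs = step (arcs 0 (s≤s z≤n)) (trace-walk m (λ i i<m → arcs (suc i) (s≤s i<m)))

∈-trace : ∀ {A : Set} {g : ℕ → A} {i m} → i ≤ m → g i ∈ trace g m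
∈-trace z≤n       = here refl
∈-trace (s≤s i≤m) = there (∈-trace i≤m)

-- Lower bound: the bottleneck instance

-- The level of (l , x) is l and its index is x. Indices are halved on the way up to
-- level r, where only index 0 is left of the sources, and doubled again afterwards.
module Bottleneck (r : ℕ) (1≤r : 1 ≤ r) where

  k top size : ℕ
  k    = 2 ^ r
  top  = r + r
  size = suc top * k

  level index : Fin size → ℕ
  level v = toℕ (proj₁ (remQuot {suc top} k v))
  index v = toℕ (proj₂ (remQuot {suc top} k v))

  -- The first alternative contains the tree arcs, the second the additional arc from a source to
  -- its own target.
  Arc : ℕ → ℕ → ℕ → ℕ → Set
  Arc l x l′ y = (l′ ≡ suc l × (l < r × y ≡ ⌊ x /2⌋ ⊎ r ≤ l × x ≡ ⌊ y /2⌋))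
               ⊎ (l ≡ 0 × l′ ≡ top × x ≡ y)

  arc? : ∀ l x l′ y → Dec (Arc l x l′ y)
  arc? l x l′ y = (l′ ℕ.≟ suc l ×-dec (l <? r ×-dec y ℕ.≟ ⌊ x /2⌋ ⊎-dec r ≤? l ×-dec x ℕ.≟ ⌊ y /2⌋))
                ⊎-dec (l ℕ.≟ 0 ×-dec l′ ℕ.≟ top ×-dec x ℕ.≟ y)

  arc : Adj size
  arc u v = isYes (arc? (level u) (index u) (level v) (index v))

  arc⁻ : ∀ {u v} → arc u v ≡ true → Arc (level u) (index u) (level v) (index v)
  arc⁻ e = toWitness (Equivalence.from T-≡ e)

  arc⁺ : ∀ {u v} → Arc (level u) (index u) (level v) (index v) → arc u v ≡ true
  arc⁺ a = Equivalence.to T-≡ (fromWitness a)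

  1≤top : 1 ≤ top
  1≤top = ≤-trans 1≤r (m≤m+n r r)

  ascending : ∀ {u v} → arc u v ≡ true → level u < level v
  ascending {u} {v} e with arc⁻ {u} {v} e
  ... | inj₁ (eq , _)         = ≤-reflexive (sym eq)
  ... | inj₂ (eq , eq′ , _)   = ≤-trans (s≤s (≤-reflexive eq)) (≤-trans 1≤top (≤-reflexive (sym eq′)))

  open Graded arc level ascending

  coordinates-injective : Injective _≡_ _≡_ (λ v → level v , index v)
  coordinates-injective {u} {v} eq with eqˡ , eqʳ ← ,-injective eq = begin
    u                                            ≡⟨ combine-remQuot {suc top} k u ⟨
    uncurry combine (remQuot {suc top} k u)      ≡⟨ cong₂ combine (toℕ-injective eqˡ) (toℕ-injective eqʳ) ⟩
    uncurry combine (remQuot {suc top} k v)      ≡⟨ combine-remQuot {suc top} k v ⟩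
    v                                            ∎
    where open ≡-Reasoning

  degree : MaxDegreeAtMost arc 8
  degree v = +-mono-≤ (length-filterᵇ-≤ ins coordinates-injective in∈)
                      (length-filterᵇ-≤ outs coordinates-injective out∈)
    where
    l = level v
    x = index v
    ins outs : List (ℕ × ℕ)
    -- Four candidates in each direction give 8: the two indices whose half is `x`, the half of `x`,
    -- and the end of the additional arc.
    ins  = (pred l , 2 * x) ∷ (pred l , suc (2 * x)) ∷ (pred l , ⌊ x /2⌋) ∷ (0 , x) ∷ []
    outs = (suc l , 2 * x) ∷ (suc l , suc (2 * x)) ∷ (suc l , ⌊ x /2⌋) ∷ (top , x) ∷ []

    in∈ : ∀ u → arc u v ≡ true → (level u , index u) ∈ ins
    in∈ u e with arc⁻ {u} {v} e
    ... | inj₂ (eq , _ , eq′)              = there (there (there (here (cong₂ _,_ eq eq′))))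
    ... | inj₁ (eq , inj₂ (_ , eq′))       = there (there (here (cong₂ _,_ (cong pred (sym eq)) eq′)))
    ... | inj₁ (eq , inj₁ (_ , eq′)) with n≡2*⌊n/2⌋∨1+2*⌊n/2⌋ (index u)
    ...   | inj₁ even = here (cong₂ _,_ (cong pred (sym eq)) (trans even (cong (2 *_) (sym eq′))))
    ...   | inj₂ odd  = there (here (cong₂ _,_ (cong pred (sym eq)) (trans odd (cong (λ h → 1 + 2 * h) (sym eq′)))))

    out∈ : ∀ u → arc v u ≡ true → (level u , index u) ∈ outs
    out∈ u e with arc⁻ {v} {u} e
    ... | inj₂ (_ , eq , eq′)              = there (there (there (here (cong₂ _,_ eq (sym eq′)))))
    ... | inj₁ (eq , inj₁ (_ , eq′))       = there (there (here (cong₂ _,_ eq eq′)))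
    ... | inj₁ (eq , inj₂ (_ , eq′)) with n≡2*⌊n/2⌋∨1+2*⌊n/2⌋ (index u)
    ...   | inj₁ even = here (cong₂ _,_ eq (trans even (cong (2 *_) (sym eq′))))
    ...   | inj₂ odd  = there (here (cong₂ _,_ eq (trans odd (cong (λ h → 1 + 2 * h) (sym eq′)))))

  -- Makes `node` total on ℕ, so that routes are plain functions of the level; the cap is inactive
  -- for levels up to `top`.
  clamp : ℕ → Fin (suc top)
  clamp l = fromℕ< (s≤s (m⊓n≤n l top))

  node : ℕ → Fin k → Fin size
  node l x = combine (clamp l) x

  level-node : ∀ {l} x → l ≤ top → level (node l x) ≡ l
  level-node {l} x l≤top = begin
    level (node l x)   ≡⟨ cong (toℕ ∘ proj₁) (remQuot-combine (clamp l) x) ⟩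
    toℕ (clamp l)      ≡⟨ toℕ-fromℕ< _ ⟩
    l ⊓ top            ≡⟨ m≤n⇒m⊓n≡m l≤top ⟩
    l                  ∎
    where open ≡-Reasoning

  index-node : ∀ l x → index (node l x) ≡ toℕ x
  index-node l x = cong (toℕ ∘ proj₂) (remQuot-combine (clamp l) x)

  arc-node : ∀ {l l′} x y → l ≤ top → l′ ≤ top → Arc l (toℕ x) l′ (toℕ y) →
             arc (node l x) (node l′ y) ≡ true
  arc-node {l} {l′} x y l≤ l′≤ a = arc⁺ {node l x} {node l′ y} a′
    where
    a′ : Arc (level (node l x)) (index (node l x)) (level (node l′ y)) (index (node l′ y))
    a′ rewrite level-node x l≤ | level-node y l′≤ | index-node l x | index-node l′ y = a

  node-injective : ∀ {l} → Injective _≡_ _≡_ (node l)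
  node-injective {l} {x} {y} = combine-injectiveʳ (clamp l) x (clamp l) y

  bottom≢top : ∀ x y → node 0 x ≢ node top y
  bottom≢top x y eq = <⇒≢ 1≤top (begin
    0                    ≡⟨ level-node x z≤n ⟨
    level (node 0 x)     ≡⟨ cong level eq ⟩
    level (node top y)   ≡⟨ level-node y ≤-refl ⟩
    top                  ∎)
    where open ≡-Reasoning

  direct : ∀ x → IsWalk arc (node 0 x) (node top x) (node 0 x ∷ node top x ∷ [])
  direct x = step (arc-node {0} {top} x x z≤n ≤-refl (inj₂ (refl , refl , refl))) (single _)

  -- Routes through the root

  half : Fin k → Fin k
  half x = fromℕ< (≤-<-trans (⌊n/2⌋≤n (toℕ x)) (toℕ<n x))

  toℕ-half : ∀ x → toℕ (half x) ≡ ⌊ toℕ x /2⌋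
  toℕ-half x = toℕ-fromℕ< _

  halve : ℕ → Fin k → Fin k
  halve zero    x = x
  halve (suc m) x = half (halve m x)

  halve-< : ∀ m e x → toℕ x < 2 ^ (m + e) → toℕ (halve m x) < 2 ^ e
  halve-< zero    e x x< = x<
  halve-< (suc m) e x x< = *-cancelˡ-< 2 (toℕ (half (halve m x))) (2 ^ e) (begin-strict
    2 * toℕ (half (halve m x))     ≡⟨ cong (2 *_) (toℕ-half (halve m x)) ⟩
    2 * ⌊ toℕ (halve m x) /2⌋      ≤⟨ 2*⌊n/2⌋≤n (toℕ (halve m x)) ⟩
    toℕ (halve m x)                <⟨ halve-< m (suc e) x (subst (λ a → toℕ x < 2 ^ a) (sym (+-suc m e)) x<) ⟩
    2 ^ suc e                      ∎)
    where open ≤-Reasoning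

  halve-root : ∀ x y → halve r x ≡ halve r y
  halve-root x y = toℕ-injective (trans (vanish x) (sym (vanish y)))
    where
    vanish : ∀ x → toℕ (halve r x) ≡ 0
    vanish x = n<1⇒n≡0 (halve-< r 0 x (subst (λ a → toℕ x < 2 ^ a) (sym (+-identityʳ r)) (toℕ<n x)))

  -- `l ⊓ (top ∸ l)` is the number of halvings in force at level `l`: it climbs to `r` at the root
  -- and falls back to 0.
  stage : Fin k → ℕ → Fin size
  stage x l = node l (halve (l ⊓ (top ∸ l)) x)

  stage-top : ∀ x → stage x top ≡ node top x
  stage-top x = cong (λ m → node top (halve m x)) (trans (cong (top ⊓_) (n∸n≡0 top)) (⊓-zeroʳ top))

  stage-root : ∀ x y → stage x r ≡ stage y r
  stage-root x y = cong (node r)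
    (trans (cong (λ m → halve m x) r⊓) (trans (halve-root x y) (cong (λ m → halve m y) (sym r⊓))))
    where
    r⊓ : r ⊓ (top ∸ r) ≡ r
    r⊓ = trans (cong (r ⊓_) (m+n∸n≡m r r)) (⊓-idem r)

  stage-arc : ∀ x l → l < top → arc (stage x l) (stage x (suc l)) ≡ true
  stage-arc x l l<top = arc-node _ _ (<⇒≤ l<top) l<top (inj₁ (refl , branch))
    where
    a = l ⊓ (top ∸ l)
    b = suc l ⊓ (top ∸ suc l)
    toℕ-halve : ∀ {m m′} → m′ ≡ suc m → toℕ (halve m′ x) ≡ ⌊ toℕ (halve m x) /2⌋
    toℕ-halve {m} refl = toℕ-half (halve m x)
    lower : ∀ {j} → j ≤ r → j ⊓ (top ∸ j) ≡ j
    lower {j} j≤r = m≤n⇒m⊓n≡m (m+n≤o⇒m≤o∸n j (+-mono-≤ j≤r j≤r))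
    upper : ∀ {j} → r ≤ j → j ⊓ (top ∸ j) ≡ top ∸ j
    upper {j} r≤j = m≥n⇒m⊓n≡n (m≤n+o⇒m∸n≤o top j (+-mono-≤ r≤j r≤j))
    branch : l < r × toℕ (halve b x) ≡ ⌊ toℕ (halve a x) /2⌋ ⊎
             r ≤ l × toℕ (halve a x) ≡ ⌊ toℕ (halve b x) /2⌋
    branch with <-≤-connex l r
    ... | inj₁ l<r = inj₁ (l<r , toℕ-halve (trans (lower l<r) (cong suc (sym (lower (<⇒≤ l<r))))))
    -- From the root on, one halving is undone per level, so the earlier index is half of the later
    -- one.
    ... | inj₂ r≤l = inj₂ (r≤l , toℕ-halve (trans (upper r≤l)
            (trans (sym 1+[top∸1+l]≡top∸l) (cong suc (sym (upper (m≤n⇒m≤1+n r≤l)))))))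
      where
      1+[top∸1+l]≡top∸l : suc (top ∸ suc l) ≡ top ∸ l
      1+[top∸1+l]≡top∸l = sym (+-∸-assoc 1 l<top)

  detour : Fin k → List (Fin size)
  detour x = trace (stage x) top

  detour-walk : ∀ x → IsWalk arc (node 0 x) (node top x) (detour x)
  detour-walk x = subst (λ v → IsWalk arc (node 0 x) v (detour x)) (stage-top x) (trace-walk top (stage-arc x))

  inst : Instance k
  inst = record
    { n = size ; E = arc ; λ' = gap
    ; λ-pos = λ u v e → m<n⇒0<n∸m (ascending {u} {v} e)
    ; s = node 0 ; t = node top
    ; s-inj = node-injective {0} ; t-inj = node-injective {top} ; s≢t = bottom≢top
    ; reach = λ x → _ , direct x }

  length-top : ∀ {x ws} → IsWalk arc (node 0 x) (node top x) ws → walkLen gap ws ≡ top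
  length-top {x} {ws} w = begin
    walkLen gap ws                       ≡⟨ +-identityʳ _ ⟨
    walkLen gap ws + 0                   ≡⟨ cong (walkLen gap ws +_) (level-node x z≤n) ⟨
    walkLen gap ws + level (node 0 x)    ≡⟨ walkLen-gap w ⟩
    level (node top x)                   ≡⟨ level-node x ≤-refl ⟩
    top                                  ∎
    where open ≡-Reasoning

  -- Hence any two detours reach a common vertex with time shift 0.
  arrival-level : ∀ {x v a} → (v , a) ∈ arrivals gap 0 (detour x) → a ≡ level v
  arrival-level {x} {v} {a} a∈ = begin
    a                        ≡⟨ +-identityʳ a ⟨
    a + 0                    ≡⟨ cong (a +_) (level-node x z≤n) ⟨
    a + level (node 0 x)     ≡⟨ arrival-gap (detour-walk x) a∈ ⟩
    level v                  ∎
    where open ≡-Reasoning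

  -- The greedy output against a cheaper schedule

  output : Schedule k size
  output = toℕ , detour

  output-valid : AlgOutput inst output
  output-valid =
    (λ x → (detour-walk x , walk-unique graded⇒dag (detour-walk x)) ,
           λ _ p → ≤-reflexive (trans (length-top {x} (detour-walk x)) (sym (length-top (proj₁ p))))) ,
    -- All chosen paths have length `top`, so the identity order is a valid tie-breaking.
    id , id ,
    (λ x y _ → ≤-reflexive (trans (length-top {x} (detour-walk x)) (sym (length-top {y} (detour-walk y))))) ,
    λ x → unblocked x , blocked-below x
    where
    unblocked : ∀ x → ¬ InB inst id output x (toℕ x)
    unblocked x (y , y<x , v , a , b , a∈ , b∈ , eq)
      with refl ← arrival-level {x} a∈ | refl ← arrival-level {y} b∈ =
      <⇒≢ y<x (sym (+-cancelʳ-≡ (level v) (toℕ x) (toℕ y) eq))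
    blocked-below : ∀ x d → d < toℕ x → InB inst id output x d
    blocked-below x d d<x
      -- Delay `d` is blocked by the demand with index `d`, at the root.
      with a , a∈ ← ∈-arrivals {λ' = gap} 0 (∈-trace {g = stage x} (m≤m+n r r))
      with b , b∈ ← ∈-arrivals {λ' = gap} 0 (∈-trace {g = stage (fromℕ< (<-trans d<x (toℕ<n x)))} (m≤m+n r r)) =
      y , subst (_< toℕ x) (sym toℕy≡d) d<x ,
      stage x r , a , b , a∈ , b∈′ ,
      cong₂ _+_ (sym toℕy≡d) (trans (arrival-level {x} a∈) (sym (arrival-level {y} b∈′)))
      where
      y = fromℕ< (<-trans d<x (toℕ<n x))
      toℕy≡d = toℕ-fromℕ< (<-trans d<x (toℕ<n x))
      b∈′ : (stage x r , b) ∈ arrivals gap 0 (detour y)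
      b∈′ = subst (λ v → (v , b) ∈ arrivals gap 0 (detour y)) (stage-root y x) b∈

  optimum : Schedule k size
  optimum = (λ _ → 0) , λ x → node 0 x ∷ node top x ∷ []

  optimum-feasible : Feasible inst optimum
  optimum-feasible = direct , disjoint
    where
    disjoint : ∀ x y → x ≢ y → TimeDisjoint gap 0 (proj₂ optimum x) 0 (proj₂ optimum y)
    disjoint x y x≢y v a b (here refl)         (here eq)         _ = x≢y (node-injective {0} (cong proj₁ eq))
    disjoint x y x≢y v a b (here refl)         (there (here eq)) _ = bottom≢top x y (cong proj₁ eq)
    disjoint x y x≢y v a b (there (here refl)) (here eq)         _ = bottom≢top y x (sym (cong proj₁ eq))
    disjoint x y x≢y v a b (there (here refl)) (there (here eq)) _ = x≢y (node-injective {top} (cong proj₁ eq))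

  cost-optimum : cost inst optimum ≡ k * top
  cost-optimum = begin
    cost inst optimum                       ≡⟨ cong sum (map-cong (λ x → length-top {x} (direct x)) (allFin k)) ⟩
    sum (map (λ _ → top) (allFin k))        ≡⟨ cong sum (map-tabulate {n = k} id (λ _ → top)) ⟩
    sum (tabulate {n = k} (λ _ → top))      ≡⟨ sum-tabulate-const k top ⟩
    k * top                                 ∎
    where open ≡-Reasoning

  -- Twice the cost plus `k` is k² + 2k `top`, and the second summand already exceeds `k`.
  cost-output : k * k ≤ 2 * cost inst output
  cost-output = +-cancelʳ-≤ k _ _ (begin
    k * k + k                                               ≤⟨ +-monoʳ-≤ (k * k) k≤2k*top ⟩
    k * k + 2 * k * top                                     ≡⟨ sum-tabulate-toℕ k top ⟨
    2 * sum (tabulate {n = k} (λ i → toℕ i + top)) + k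
      ≡⟨ cong (λ c → 2 * sum c + k) (map-tabulate {n = k} id (λ i → toℕ i + top)) ⟨
    2 * sum (map (λ i → toℕ i + top) (allFin k)) + k
      ≡⟨ cong (λ c → 2 * sum c + k) (map-cong (λ x → cong (toℕ x +_) (length-top {x} (detour-walk x))) (allFin k)) ⟨
    2 * cost inst output + k                                ∎)
    where
    open ≤-Reasoning
    k≤2k*top : k ≤ 2 * k * top
    k≤2k*top = begin
      k             ≡⟨ *-identityʳ k ⟨
      k * 1         ≤⟨ *-mono-≤ (m≤m+n k (k + 0)) 1≤top ⟩
      2 * k * top   ∎

  -- One factor 2 of the constant comes from the triangular sum of the delays, the other from `top`
  -- = 2r, where r = log k.
  ratio : k * cost inst optimum ≤ 4 * cost inst output * ⌊log₂ k ⌋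
  ratio = begin
    k * cost inst optimum                 ≡⟨ cong (k *_) cost-optimum ⟩
    k * (k * (r + r))                     ≡⟨ *-assoc k k (r + r) ⟨
    k * k * (r + r)                       ≤⟨ *-monoˡ-≤ (r + r) cost-output ⟩
    2 * cost inst output * (r + r)        ≡⟨ double (cost inst output) r ⟩
    4 * cost inst output * r              ≡⟨ cong (4 * cost inst output *_) (⌊log₂[2^n]⌋≡n r) ⟨
    4 * cost inst output * ⌊log₂ k ⌋      ∎
    where
    open ≤-Reasoning
    double : ∀ c r → 2 * c * (r + r) ≡ 4 * c * r
    double = solve-∀

lower-bound : LowerBound
-- Taking r = N + 1 ensures 1 ≤ r and N ≤ 2^r.
lower-bound = 8 , 4 , s≤s z≤n , λ N → let open Bottleneck (suc N) (s≤s z≤n) in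
  2 ^ suc N , ≤-trans (m≤n+m N 2) (1+n≤2^n (suc N)) , inst ,
  Graded.graded⇒dag arc level (λ {u} {v} → ascending {u} {v}) , degree ,
  output , output-valid , optimum , optimum-feasible , ratio

theorem6p2 : UpperBound × LowerBound
theorem6p2 = upper-bound , lower-bound
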